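{- For every $\varepsilon>0$ there exists $N$ such that for every integer $n\ge N$ there exist a graph $G$ of order $n$ with maximum vertex degree $\Delta$ and an integer $k$ with $1\le k\le \Delta$ such that $$ L_k(G)\;\le\;(1+\varepsilon)\,\frac{k\,n}{\tilde c_{k+1}^{\,1/k}\,(1+k)^{1+1/k}},\qquad\text{where } \tilde c_{k+1}=\binom{\Delta+1}{k+1}. $$
   Context: Graphs are finite, simple and undirected. $N[v]$ denotes the closed neighbourhood of a vertex $v$ (the vertex $v$ together with all its neighbours). A vertex set $X\subseteq V(G)$ is a $k$-limited packing of $G$ if $|N[v]\cap X|\le k$ for every vertex $v\in V(G)$. The $k$-limited packing number $L_k(G)$ is the maximum size of a $k$-limited packing in $G$. -}

module Defs where

open import Level using (0ℓ)
open import Data.Fin using (Fin)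
import Data.Fin.Properties as Fin
open import Data.Fin.Subset using (Subset; inside; outside; ⁅_⁆; _∪_; _∩_; ∣_∣; ⊥)
open import Data.Fin.Subset.Properties using (∣⊥∣≡0; ∩-zeroʳ)
import Data.Integer as ℤ
import Data.Integer.Properties as ℤ
open import Data.List using (List; []; _∷_; _++_; map; filter; allFin)
open import Data.List.Extrema.Nat using (max; argmax-sel; xs≤max)
open import Data.List.Membership.Propositional using (_∈_)
open import Data.List.Membership.Propositional.Properties
  using (∈-++⁺ˡ; ∈-++⁺ʳ; ∈-map⁺; ∈-map⁻; ∈-filter⁺; ∈-filter⁻)
import Data.List.Relation.Unary.All as All
open import Data.List.Relation.Unary.Any using (here)
open import Data.Nat using (ℕ; zero; suc; NonZero)
import Data.Nat as ℕ
import Data.Nat.Properties as ℕ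
open import Data.Nat.Combinatorics using (_C_; nCk+nC[k+1]≡[n+1]C[k+1])
open import Data.Product using (∃; ∃-syntax; _×_; _,_; proj₁; proj₂)
open import Data.Rational
  using (ℚ; mkℚ; 0ℚ; 1ℚ; _+_; _*_; _-_; -_; _⊔_; _⊓_; _≤_; _<_; *≤*; *<*;
         positive; nonNegative)
import Data.Rational as ℚ
open import Data.Rational.Properties
import Data.Rational.Unnormalised as ℚᵘ
import Data.Rational.Unnormalised.Properties as ℚᵘ
open import Data.Rational.Solver using (module +-*-Solver)
open import Data.Sum using (_⊎_; inj₁; inj₂)
open import Data.Vec using (tabulate; []; _∷_)
open import Relation.Binary using (Rel; Symmetric; Irreflexive; Decidable)
open import Relation.Binary.PropositionalEquality
  using (_≡_; refl; sym; trans; cong; cong₂; subst; subst₂)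
open import Relation.Nullary using (¬_; Dec; yes; no; does; contradiction)
open import Algebra.Definitions.RawSemiring ℚ.+-*-rawSemiring using (_^_)

open +-*-Solver using (solve; _:=_; _:+_; _:*_; :-_; _:-_; con)

0<1 : 0ℚ < 1ℚ
0<1 = *<* (ℤ.+<+ (ℕ.s≤s ℕ.z≤n))

*-mono-≤₀ : ∀ {a b c d} → 0ℚ ≤ a → a ≤ b → 0ℚ ≤ c → c ≤ d → a * c ≤ b * d
*-mono-≤₀ {a} {b} {c} 0≤a a≤b 0≤c c≤d = ≤-trans
  (*-monoʳ-≤-nonNeg c {{nonNegative 0≤c}} a≤b)
  (*-monoˡ-≤-nonNeg b {{nonNegative (≤-trans 0≤a a≤b)}} c≤d)

*-mono-<₀ : ∀ {a b c d} → 0ℚ ≤ a → a < b → 0ℚ ≤ c → c < d → a * c < b * d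
*-mono-<₀ {a} {b} {c} 0≤a a<b 0≤c c<d = ≤-<-trans
  (*-monoʳ-≤-nonNeg c {{nonNegative 0≤c}} (<⇒≤ a<b))
  (*-monoʳ-<-pos b {{positive (≤-<-trans 0≤a a<b)}} c<d)

*-nonNeg : ∀ {a b} → 0ℚ ≤ a → 0ℚ ≤ b → 0ℚ ≤ a * b
*-nonNeg {a} {b} 0≤a 0≤b = *-mono-≤₀ {0ℚ} {a} {0ℚ} {b} ≤-refl 0≤a ≤-refl 0≤b

*-pos : ∀ {a b} → 0ℚ < a → 0ℚ < b → 0ℚ < a * b
*-pos {a} {b} 0<a 0<b = *-mono-<₀ {0ℚ} {a} {0ℚ} {b} ≤-refl 0<a ≤-refl 0<b

abstract
  reciprocal : ∀ {a} → 0ℚ < a → ∃[ b ] 0ℚ < b × a * b ≡ 1ℚ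
  reciprocal {a} 0<a =
    let instance a>0 = positive 0<a
                 a≢0 = pos⇒nonZero a
    in ℚ.1/ a , positive⁻¹ (ℚ.1/ a) {{1/pos⇒pos a}} , *-inverseʳ a

p<p+q : ∀ p {q} → 0ℚ < q → p < p + q
p<p+q p {q} 0<q = subst (_< p + q) (+-identityʳ p) (+-monoʳ-< p 0<q)

0<+ : ∀ {p q} → 0ℚ < p → 0ℚ < q → 0ℚ < p + q
0<+ {p} {q} 0<p 0<q = <-trans 0<p (p<p+q p 0<q)

0<q-p : ∀ {p q} → p < q → 0ℚ < q - p
0<q-p {p} {q} p<q = subst (_< q - p) (+-inverseʳ p) (+-monoˡ-< (- p) p<q)

p+[q-p] : ∀ p q → p + (q - p) ≡ q
p+[q-p] = solve 2 (λ p q → p :+ (q :- p) := q) refl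

-‿involutive : ∀ p → - (- p) ≡ p
-‿involutive = solve 1 (λ p → :- (:- p) := p) refl

sum-shift : ∀ a b η → (a + b) + (η + η) ≡ (a + η) + (b + η)
sum-shift = solve 3 (λ a b η → (a :+ b) :+ (η :+ η) := (a :+ η) :+ (b :+ η)) refl

product-shift : ∀ a b η → a * b + η * (a + b + η) ≡ (a + η) * (b + η)
product-shift = solve 3 (λ a b η → a :* b :+ η :* (a :+ b :+ η) := (a :+ η) :* (b :+ η)) refl

reciprocal-< : ∀ {r s r′ s′} → 0ℚ < r′ → 0ℚ < s′ → r * r′ ≡ 1ℚ → s * s′ ≡ 1ℚ → r < s → s′ < r′
reciprocal-< {r} {s} {r′} {s′} 0<r′ 0<s′ rr′≡1 ss′≡1 r<s = subst₂ _<_ left right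
  (*-monoʳ-<-pos s′ {{positive 0<s′}} (*-monoˡ-<-pos r′ {{positive 0<r′}} r<s))
  where
  left : s′ * (r * r′) ≡ s′
  left = trans (cong (s′ *_) rr′≡1) (*-identityʳ s′)
  right : s′ * (s * r′) ≡ r′
  right = trans (sym (*-assoc s′ s r′))
    (trans (cong (_* r′) (trans (*-comm s′ s) ss′≡1)) (*-identityˡ r′))

^-nonNeg : ∀ {a} k → 0ℚ ≤ a → 0ℚ ≤ a ^ k
^-nonNeg zero    0≤a = <⇒≤ 0<1
^-nonNeg (suc k) 0≤a = *-nonNeg 0≤a (^-nonNeg k 0≤a)

^-mono-≤ : ∀ {a b} k → 0ℚ ≤ a → a ≤ b → a ^ k ≤ b ^ k
^-mono-≤ zero    0≤a a≤b = ≤-refl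
^-mono-≤ (suc k) 0≤a a≤b = *-mono-≤₀ 0≤a a≤b (^-nonNeg k 0≤a) (^-mono-≤ k 0≤a a≤b)

^-mono-< : ∀ {a b} k .{{_ : NonZero k}} → 0ℚ ≤ a → a < b → a ^ k < b ^ k
^-mono-< {a} {b} (suc zero) 0≤a a<b =
  subst₂ _<_ (sym (*-identityʳ a)) (sym (*-identityʳ b)) a<b
^-mono-< (suc (suc k)) 0≤a a<b =
  *-mono-<₀ 0≤a a<b (^-nonNeg (suc k) 0≤a) (^-mono-< (suc k) 0≤a a<b)

1≤^ : ∀ {a} k → 1ℚ ≤ a → 1ℚ ≤ a ^ k
1≤^ zero    1≤a = ≤-refl
1≤^ {a} (suc k) 1≤a = *-mono-≤₀ {1ℚ} {a} {1ℚ} (<⇒≤ 0<1) 1≤a (<⇒≤ 0<1) (1≤^ k 1≤a)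

a≤^ : ∀ {a} k .{{_ : NonZero k}} → 1ℚ ≤ a → a ≤ a ^ k
a≤^ {a} (suc k) 1≤a = subst (_≤ a * a ^ k) (*-identityʳ a)
  (*-monoˡ-≤-nonNeg a {{nonNegative (≤-trans (<⇒≤ 0<1) 1≤a)}} (1≤^ k 1≤a))

^-small : ∀ {a} k .{{_ : NonZero k}} → 0ℚ ≤ a → a ≤ 1ℚ → a ^ k ≤ a
^-small {a} (suc zero) 0≤a a≤1 = ≤-reflexive (*-identityʳ a)
^-small {a} (suc (suc k)) 0≤a a≤1 = ≤-trans
  (*-mono-≤₀ 0≤a a≤1 (^-nonNeg (suc k) 0≤a) (^-small (suc k) 0≤a a≤1))
  (≤-reflexive (*-identityˡ a))

0<⊓ : ∀ {p q} → 0ℚ < p → 0ℚ < q → 0ℚ < p ⊓ q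
0<⊓ {p} {q} 0<p 0<q with ⊓-sel p q
... | inj₁ eq = subst (0ℚ <_) (sym eq) 0<p
... | inj₂ eq = subst (0ℚ <_) (sym eq) 0<q

abstract
  small : ∀ {M e} → 0ℚ < M → 0ℚ < e → ∃[ δ ] 0ℚ < δ × δ ≤ 1ℚ × δ * M < e
  small {M} {e} 0<M 0<e =
    let r , 0<r , Mr≡1 = reciprocal 0<M
        d , 0<d , d<e  = <-dense 0<e
        drM≡d = trans (*-assoc d r M) (trans (cong (d *_) (trans (*-comm r M) Mr≡1)) (*-identityʳ d))
    in 1ℚ ⊓ (d * r) , 0<⊓ 0<1 (*-pos 0<d 0<r) , p⊓q≤p 1ℚ (d * r) ,
       ≤-<-trans
         (*-monoʳ-≤-nonNeg M {{nonNegative (<⇒≤ 0<M)}} (p⊓q≤q 1ℚ (d * r)))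
         (subst (_< e) (sym drM≡d) d<e)

abstract
  half : ∀ {e} → 0ℚ < e → ∃[ δ ] 0ℚ < δ × δ + δ < e
  half {e} 0<e =
    let δ , 0<δ , _ , lt = small (0<+ 0<1 0<1) 0<e
    in δ , 0<δ , subst (_< e) (trans (*-distribˡ-+ δ 1ℚ 1ℚ) (cong₂ _+_ (*-identityʳ δ) (*-identityʳ δ))) lt

steps : ℚ → ℚ → ℕ → ℚ
steps a δ zero    = a
steps a δ (suc n) = steps (a + δ) δ n

fromℕℚ : ℕ → ℚ
fromℕℚ zero    = 0ℚ
fromℕℚ (suc n) = 1ℚ + fromℕℚ n

steps-≡ : ∀ a δ n → steps a δ n ≡ a + fromℕℚ n * δ
steps-≡ a δ zero = sym (trans (cong (a +_) (*-zeroˡ δ)) (+-identityʳ a))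
steps-≡ a δ (suc n) = trans (steps-≡ (a + δ) δ n)
  (solve 3 (λ a δ m → (a :+ δ) :+ m :* δ := a :+ (con 1ℚ :+ m) :* δ) refl a δ (fromℕℚ n))

exceeds : ∀ q → ∃[ n ] q < fromℕℚ n
exceeds q = suc m , ≤-<-trans (q≤m q) (subst (_< 1ℚ + fromℕℚ m) (+-identityˡ _) (+-monoˡ-< (fromℕℚ m) 0<1))
  where
  m = ℤ.∣ ℚ.↥ q ∣
  /1 : ℕ → ℚ
  /1 m = ℤ.+ m ℚ./ 1
  /1≡ : ∀ m → /1 m ≡ fromℕℚ m
  /1≡ zero    = refl
  /1≡ (suc m) = trans (sym step) (cong (1ℚ +_) (/1≡ m))
    where
    step : 1ℚ + /1 m ≡ /1 (suc m)
    step = toℚᵘ-injective (ℚᵘ.≃-trans (toℚᵘ-homo-+ 1ℚ (/1 m))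
      (ℚᵘ.≃-trans (ℚᵘ.+-congʳ (ℚ.toℚᵘ 1ℚ) (toℚᵘ-fromℚᵘ (ℚᵘ.mkℚᵘ (ℤ.+ m) 0)))
      (ℚᵘ.≃-trans (ℚᵘ.*≡* (cong (λ z → (ℤ.+ 1 ℤ.+ z) ℤ.* ℤ.+ 1) (ℤ.*-identityʳ (ℤ.+ m))))
        (ℚᵘ.≃-sym (toℚᵘ-fromℚᵘ (ℚᵘ.mkℚᵘ (ℤ.+ suc m) 0))))))
  q≤m : ∀ q → q ≤ fromℕℚ ℤ.∣ ℚ.↥ q ∣
  q≤m q@(mkℚ n d c) = subst (q ≤_) (/1≡ ℤ.∣ n ∣) (toℚᵘ-cancel-≤ (ℚᵘ.≤-trans le
      (ℚᵘ.≤-reflexive (ℚᵘ.≃-sym (toℚᵘ-fromℚᵘ (ℚᵘ.mkℚᵘ (ℤ.+ ℤ.∣ n ∣) 0))))))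
    where
    n≤ : ∀ n → n ℤ.≤ ℤ.+ (ℤ.∣ n ∣ ℕ.* suc d)
    n≤ (ℤ.+ n)        = ℤ.+≤+ (ℕ.m≤m*n n (suc d))
    n≤ (ℤ.-[1+ n ]) = ℤ.-≤+
    le : ℚᵘ.mkℚᵘ n d ℚᵘ.≤ ℚᵘ.mkℚᵘ (ℤ.+ ℤ.∣ n ∣) 0
    le = ℚᵘ.*≤* (subst₂ ℤ._≤_ (sym (ℤ.*-identityʳ n)) (ℤ.pos-* ℤ.∣ n ∣ (suc d)) (n≤ n))

abstract
  archimedean : ∀ a B {δ} → 0ℚ < δ → ∃[ n ] B < steps a δ n
  archimedean a B {δ} 0<δ =
    let r , 0<r , δr≡1 = reciprocal 0<δ
        n , lt = exceeds ((B - a) * r)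
        B-a≡ : (B - a) * r * δ ≡ B - a
        B-a≡ = trans (*-assoc (B - a) r δ)
                 (trans (cong ((B - a) *_) (trans (*-comm r δ) δr≡1)) (*-identityʳ (B - a)))
        lt′ : B - a < fromℕℚ n * δ
        lt′ = subst (_< fromℕℚ n * δ) B-a≡ (*-monoˡ-<-pos δ {{positive 0<δ}} lt)
    in n , subst₂ _<_ (p+[q-p] a B) (sym (steps-≡ a δ n)) (+-monoʳ-< a lt′)

-- Non-negative reals, as two-sided Dedekind cuts:  Lower q  means  q < x
-- and  Upper q  means  x < q.

record ℝ≥0 : Set₁ where
  field
    Lower Upper     : ℚ → Set
    lower-negative  : ∀ {q} → q < 0ℚ → Lower q
    upper-inhabited : ∃ Upper
    lower-open      : ∀ {p} → Lower p → ∃[ q ] p < q × Lower q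
    lower-down      : ∀ {p q} → p < q → Lower q → Lower p
    upper-open      : ∀ {q} → Upper q → ∃[ p ] p < q × Upper p
    upper-up        : ∀ {p q} → p < q → Upper p → Upper q
    separated       : ∀ {q} → Lower q → ¬ Upper q
    located         : ∀ {p q} → p < q → Lower p ⊎ Upper q

open ℝ≥0

infix 4 _≤ᴿ_
_≤ᴿ_ : ℝ≥0 → ℝ≥0 → Set
x ≤ᴿ y = ∀ {q} → Lower x q → Lower y q

Positive : ℝ≥0 → Set
Positive x = Lower x 0ℚ

lower-down-≤ : ∀ x {p q} → p ≤ q → Lower x q → Lower x p
lower-down-≤ x p≤q Lq = let r , q<r , Lr = lower-open x Lq in lower-down x (≤-<-trans p≤q q<r) Lr

upper-up-≤ : ∀ x {p q} → p ≤ q → Upper x p → Upper x q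
upper-up-≤ x p≤q Up = let r , r<p , Ur = upper-open x Up in upper-up x (<-≤-trans r<p p≤q) Ur

lower<upper : ∀ x {p q} → Lower x p → Upper x q → p < q
lower<upper x {p} {q} Lp Uq with p <? q
... | yes p<q = p<q
... | no  p≮q = contradiction (upper-up-≤ x (≮⇒≥ p≮q) Uq) (separated x Lp)

upper-pos : ∀ x {q} → Upper x q → 0ℚ < q
upper-pos x {q} Uq =
  let p , p<q , Up = upper-open x Uq
  in ≤-<-trans (≮⇒≥ (λ p<0 → separated x (lower-negative x p<0) Up)) p<q

abstract
  approximate : ∀ x {δ} → 0ℚ < δ → ∃[ a ] Lower x a × Upper x (a + (δ + δ))
  approximate x {δ} 0<δ =
    let B , UB  = upper-inhabited x
        n , B<n = archimedean (- δ) B 0<δ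
    in go n (- δ) (lower-negative x (neg-antimono-< 0<δ)) (upper-up x B<n UB)
    where
    go : ∀ n a → Lower x a → Upper x (steps a δ n) → ∃[ a ] Lower x a × Upper x (a + (δ + δ))
    go zero    a La Ua = contradiction Ua (separated x La)
    go (suc n) a La U with located x (subst (a + δ <_) (+-assoc a δ δ) (p<p+q (a + δ) 0<δ))
    ... | inj₁ La+δ = go n (a + δ) La+δ U
    ... | inj₂ Ua+δ = a , La , Ua+δ

fromℚ : (a : ℚ) → 0ℚ ≤ a → ℝ≥0
fromℚ a 0≤a = record
  { Lower           = _< a
  ; Upper           = a <_
  ; lower-negative  = λ q<0 → <-≤-trans q<0 0≤a
  ; upper-inhabited = a + 1ℚ , p<p+q a 0<1
  ; lower-open      = λ p<a → let m , p<m , m<a = <-dense p<a in m , p<m , m<a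
  ; lower-down      = <-trans
  ; upper-open      = λ a<q → let m , a<m , m<q = <-dense a<q in m , m<q , a<m
  ; upper-up        = λ p<q a<p → <-trans a<p p<q
  ; separated       = <-asym
  ; located         = loc
  }
  where
  loc : ∀ {p q} → p < q → p < a ⊎ a < q
  loc {p} p<q with p <? a
  ... | yes p<a = inj₁ p<a
  ... | no  p≮a = inj₂ (≤-<-trans (≮⇒≥ p≮a) p<q)

fromℕ : ℕ → ℝ≥0
fromℕ n = fromℚ (ℤ.+ n ℚ./ 1) (nonNegative⁻¹ _ {{normalize-nonNeg n 1}})

1ᴿ : ℝ≥0
1ᴿ = fromℕ 1

-- In the operations below the strict inequality relating q to the values
-- computed from the arguments is what makes the resulting cuts open.

infixl 6 _+ᴿ_
_+ᴿ_ : ℝ≥0 → ℝ≥0 → ℝ≥0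
x +ᴿ y = record
  { Lower           = Lo
  ; Upper           = Up
  ; lower-negative  = neg′
  ; upper-inhabited = let a , Ua = upper-inhabited x ; b , Ub = upper-inhabited y
                      in a + b + 1ℚ , a , b , Ua , Ub , p<p+q (a + b) 0<1
  ; lower-open      = λ (a , b , La , Lb , p<) → let m , p<m , m< = <-dense p<
                                                in m , p<m , a , b , La , Lb , m<
  ; lower-down      = λ p<q (a , b , La , Lb , q<) → a , b , La , Lb , <-trans p<q q<
  ; upper-open      = λ (a , b , Ua , Ub , <q) → let m , <m , m<q = <-dense <q
                                                in m , m<q , a , b , Ua , Ub , <m
  ; upper-up        = λ p<q (a , b , Ua , Ub , <p) → a , b , Ua , Ub , <-trans <p p<q
  ; separated       = λ (a , b , La , Lb , q<) (c , d , Uc , Ud , <q) →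
      <-asym (<-trans q< (+-mono-< (lower<upper x La Uc) (lower<upper y Lb Ud))) <q
  ; located         = loc
  }
  where
  Lo Up : ℚ → Set
  Lo q = ∃[ a ] ∃[ b ] Lower x a × Lower y b × q < a + b
  Up q = ∃[ a ] ∃[ b ] Upper x a × Upper y b × a + b < q
  neg′ : ∀ {q} → q < 0ℚ → Lo q
  neg′ {q} q<0 =
    let δ , 0<δ , δ+δ< = half (neg-antimono-< q<0)
        -δ<0 = neg-antimono-< 0<δ
    in - δ , - δ , lower-negative x -δ<0 , lower-negative y -δ<0 ,
       subst₂ _<_ (-‿involutive q) (neg-distrib-+ δ δ) (neg-antimono-< δ+δ<)
  loc : ∀ {p q} → p < q → Lo p ⊎ Up q
  loc {p} {q} p<q
    with half (0<q-p p<q)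
  ... | ζ , 0<ζ , ζ+ζ<
    with half 0<ζ
  ... | δ , 0<δ , δ+δ<
    with approximate x 0<δ | approximate y 0<δ
  ... | a , La , Ua | b , Lb , Ub
    with p <? a + b
  ... | yes p< = inj₁ (a , b , La , Lb , p<)
  ... | no  p≮ = inj₂ (_ , _ , Ua , Ub , subst₂ _<_
          (sum-shift a b (δ + δ))
          (p+[q-p] p q)
          (+-mono-≤-< (≮⇒≥ p≮) (<-trans (+-mono-< δ+δ< δ+δ<) ζ+ζ<)))

infixl 7 _*ᴿ_
_*ᴿ_ : ℝ≥0 → ℝ≥0 → ℝ≥0
x *ᴿ y = record
  { Lower           = Lo
  ; Upper           = Up
  ; lower-negative  = inj₁
  ; upper-inhabited = let a , Ua = upper-inhabited x ; b , Ub = upper-inhabited y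
                      in a * b + 1ℚ , a , b , Ua , Ub , p<p+q (a * b) 0<1
  ; lower-open      = lo-open
  ; lower-down      = lo-down
  ; upper-open      = λ (a , b , Ua , Ub , <q) → let m , <m , m<q = <-dense <q
                                                in m , m<q , a , b , Ua , Ub , <m
  ; upper-up        = λ p<q (a , b , Ua , Ub , <p) → a , b , Ua , Ub , <-trans <p p<q
  ; separated       = sep
  ; located         = loc
  }
  where
  Lo Up : ℚ → Set
  Lo q = q < 0ℚ ⊎ ∃[ a ] ∃[ b ] 0ℚ ≤ a × 0ℚ ≤ b × Lower x a × Lower y b × q < a * b
  Up q = ∃[ a ] ∃[ b ] Upper x a × Upper y b × a * b < q
  lo-open : ∀ {p} → Lo p → ∃[ q ] p < q × Lo q
  lo-open (inj₁ p<0) = let m , p<m , m<0 = <-dense p<0 in m , p<m , inj₁ m<0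
  lo-open (inj₂ (a , b , 0≤a , 0≤b , La , Lb , p<)) =
    let m , p<m , m< = <-dense p< in m , p<m , inj₂ (a , b , 0≤a , 0≤b , La , Lb , m<)
  lo-down : ∀ {p q} → p < q → Lo q → Lo p
  lo-down p<q (inj₁ q<0) = inj₁ (<-trans p<q q<0)
  lo-down p<q (inj₂ (a , b , 0≤a , 0≤b , La , Lb , q<)) =
    inj₂ (a , b , 0≤a , 0≤b , La , Lb , <-trans p<q q<)
  sep : ∀ {q} → Lo q → ¬ Up q
  sep (inj₁ q<0) (c , d , Uc , Ud , <q) =
    <-asym q<0 (<-trans (*-pos (upper-pos x Uc) (upper-pos y Ud)) <q)
  sep (inj₂ (a , b , 0≤a , 0≤b , La , Lb , q<)) (c , d , Uc , Ud , <q) =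
    <-asym (<-trans q< (*-mono-<₀ 0≤a (lower<upper x La Uc) 0≤b (lower<upper y Lb Ud))) <q
  loc : ∀ {p q} → p < q → Lo p ⊎ Up q
  loc {p} {q} p<q with p <? 0ℚ
  ... | yes p<0 = inj₁ (inj₁ p<0)
  ... | no  p≮0 = main
    where
    0≤p = ≮⇒≥ p≮0
    B = proj₁ (upper-inhabited x)
    D = proj₁ (upper-inhabited y)
    UB = proj₂ (upper-inhabited x)
    UD = proj₂ (upper-inhabited y)
    0<B = upper-pos x UB
    0<D = upper-pos y UD
    M = B + D + 1ℚ
    0<M : 0ℚ < M
    0<M = 0<+ (0<+ 0<B 0<D) 0<1
    main : Lo p ⊎ Up q
    main with small 0<M (0<q-p p<q)
    ... | ζ , 0<ζ , ζ≤1 , ζM< with half 0<ζ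
    ... | δ , 0<δ , δ+δ<ζ with approximate x 0<δ | approximate y 0<δ
    ... | a , La , Ua | b , Lb , Ub = result
      where
      η = δ + δ
      0<η : 0ℚ < η
      0<η = 0<+ 0<δ 0<δ
      η≤1 : η ≤ 1ℚ
      η≤1 = ≤-trans (<⇒≤ δ+δ<ζ) ζ≤1
      a<B = lower<upper x La UB
      b<D = lower<upper y Lb UD
      ηM< : η * M < q - p
      ηM< = <-trans (*-monoˡ-<-pos M {{positive 0<M}} δ+δ<ζ) ζM<
      q-p≤q : q - p ≤ q
      q-p≤q = subst (q - p ≤_) (+-identityʳ q) (+-monoʳ-≤ q (neg-antimono-≤ 0≤p))
      upper : (a + η) * (b + η) < q → Lo p ⊎ Up q
      upper lt = inj₂ (a + η , b + η , Ua , Ub , lt)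
      -- if one factor is below η, the product of the upper bounds is small
      tiny : ∀ {u v} → 0ℚ < u → u < η → 0ℚ < v → v < M → u * v < q
      tiny 0<u u<η 0<v v<M = <-trans (*-mono-<₀ (<⇒≤ 0<u) u<η (<⇒≤ 0<v) v<M) (<-≤-trans ηM< q-p≤q)
      below : ∀ {a} → a < 0ℚ → a + η < η
      below {a} a<0 = subst (a + η <_) (+-identityˡ η) (+-monoˡ-< η a<0)
      a+η<M : a + η < M
      a+η<M = +-mono-<-≤ (<-trans a<B (p<p+q B 0<D)) η≤1
      b+η<M : b + η < M
      b+η<M = +-mono-<-≤ (<-trans b<D (subst (D <_) (+-comm D B) (p<p+q D 0<B))) η≤1
      result : Lo p ⊎ Up q
      result with a <? 0ℚ
      ... | yes a<0 = upper (tiny (upper-pos x Ua) (below a<0) (upper-pos y Ub) b+η<M)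
      ... | no  a≮0 with b <? 0ℚ
      ...   | yes b<0 = upper (subst (_< q) (*-comm (b + η) (a + η))
                          (tiny (upper-pos y Ub) (below b<0) (upper-pos x Ua) a+η<M))
      ...   | no  b≮0 with p <? a * b
      ...     | yes p<ab = inj₁ (inj₂ (a , b , ≮⇒≥ a≮0 , ≮⇒≥ b≮0 , La , Lb , p<ab))
      ...     | no  p≮ab = upper (subst₂ _<_
                  (product-shift a b η)
                  (p+[q-p] p q)
                  (+-mono-≤-< (≮⇒≥ p≮ab) (≤-<-trans
                    (*-monoˡ-≤-nonNeg η {{nonNegative (<⇒≤ 0<η)}}
                      (+-mono-≤ (<⇒≤ (+-mono-< a<B b<D)) η≤1))
                    ηM<)))

recip : (x : ℝ≥0) → Positive x → ℝ≥0
recip x 0<x = record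
  { Lower           = Lo
  ; Upper           = Up
  ; lower-negative  = neg′
  ; upper-inhabited = bound′
  ; lower-open      = λ (r , u , q<r , Uu , ru≤1) → let m , q<m , m<r = <-dense q<r
                                                   in m , q<m , r , u , m<r , Uu , ru≤1
  ; lower-down      = λ p<q (r , u , q<r , Uu , ru≤1) → r , u , <-trans p<q q<r , Uu , ru≤1
  ; upper-open      = λ (r , l , r<q , 0≤r , Ll , 1≤rl) → let m , r<m , m<q = <-dense r<q
                                                         in m , m<q , r , l , r<m , 0≤r , Ll , 1≤rl
  ; upper-up        = λ p<q (r , l , r<p , 0≤r , Ll , 1≤rl) → r , l , <-trans r<p p<q , 0≤r , Ll , 1≤rl
  ; separated       = sep
  ; located         = loc
  }
  where
  -- q < 1/x  iff  q < r ≤ 1/u for some r and some u > x; dually for Up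
  Lo Up : ℚ → Set
  Lo q = ∃[ r ] ∃[ u ] q < r × Upper x u × r * u ≤ 1ℚ
  Up q = ∃[ r ] ∃[ l ] r < q × 0ℚ ≤ r × Lower x l × 1ℚ ≤ r * l
  neg′ : ∀ {q} → q < 0ℚ → Lo q
  neg′ q<0 = let u , Uu = upper-inhabited x
             in 0ℚ , u , q<0 , Uu , ≤-trans (≤-reflexive (*-zeroˡ u)) (<⇒≤ 0<1)
  bound′ : ∃ Up
  bound′ = let l , 0<l , Ll = lower-open x 0<x
               r , 0<r , lr≡1 = reciprocal 0<l
           in r + 1ℚ , r , l , p<p+q r 0<1 , <⇒≤ 0<r , Ll ,
              ≤-reflexive (trans (sym lr≡1) (*-comm l r))
  sep : ∀ {q} → Lo q → ¬ Up q
  sep (r , u , q<r , Uu , ru≤1) (r′ , l , r′<q , 0≤r′ , Ll , 1≤r′l) =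
    <-irrefl refl (<-≤-trans (≤-<-trans 1≤r′l r′l<ru) ru≤1)
    where
    r′<r = <-trans r′<q q<r
    0<u = upper-pos x Uu
    r′l<ru : r′ * l < r * u
    r′l<ru = ≤-<-trans
      (*-monoˡ-≤-nonNeg r′ {{nonNegative 0≤r′}} (<⇒≤ (lower<upper x Ll Uu)))
      (*-monoˡ-<-pos u {{positive 0<u}} r′<r)
  loc : ∀ {p q} → p < q → Lo p ⊎ Up q
  loc {p} {q} p<q with p <? 0ℚ
  ... | yes p<0 = inj₁ (neg′ p<0)
  ... | no  p≮0 with <-dense p<q
  ... | r , p<r , r<q with <-dense r<q
  ... | s , r<s , s<q = result
    where
    0<r = ≤-<-trans (≮⇒≥ p≮0) p<r
    0<s = <-trans 0<r r<s
    r⁻¹ = reciprocal 0<r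
    s⁻¹ = reciprocal 0<s
    r′ = proj₁ r⁻¹
    s′ = proj₁ s⁻¹
    0<r′ = proj₁ (proj₂ r⁻¹)
    0<s′ = proj₁ (proj₂ s⁻¹)
    s′<r′ : s′ < r′
    s′<r′ = reciprocal-< 0<r′ 0<s′ (proj₂ (proj₂ r⁻¹)) (proj₂ (proj₂ s⁻¹)) r<s
    result : Lo p ⊎ Up q
    result with located x s′<r′
    ... | inj₁ Ls′ = inj₂ (s , s′ , s<q , <⇒≤ 0<s , Ls′ , ≤-reflexive (sym (proj₂ (proj₂ s⁻¹))))
    ... | inj₂ Ur′ = inj₁ (r , r′ , p<r , Ur′ , ≤-reflexive (proj₂ (proj₂ r⁻¹)))

_/ᴿ_[_] : (x y : ℝ≥0) → Positive y → ℝ≥0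
x /ᴿ y [ 0<y ] = x *ᴿ recip y 0<y

infixr 8 _^ᴿ_
_^ᴿ_ : ℝ≥0 → ℕ → ℝ≥0
x ^ᴿ zero  = 1ᴿ
x ^ᴿ suc m = x *ᴿ x ^ᴿ m

root : (k : ℕ) → .{{NonZero k}} → ℝ≥0 → ℝ≥0
root k x = record
  { Lower           = Lo
  ; Upper           = Up
  ; lower-negative  = inj₁
  ; upper-inhabited = bound′
  ; lower-open      = lo-open
  ; lower-down      = lo-down
  ; upper-open      = λ (r , 0≤r , r<q , Ur) → let m , r<m , m<q = <-dense r<q
                                              in m , m<q , r , 0≤r , r<m , Ur
  ; upper-up        = λ p<q (r , 0≤r , r<p , Ur) → r , 0≤r , <-trans r<p p<q , Ur
  ; separated       = sep
  ; located         = loc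
  }
  where
  Lo Up : ℚ → Set
  Lo q = q < 0ℚ ⊎ ∃[ r ] 0ℚ ≤ r × q < r × Lower x (r ^ k)
  Up q = ∃[ r ] 0ℚ ≤ r × r < q × Upper x (r ^ k)
  bound′ : ∃ Up
  bound′ =
    let B , UB = upper-inhabited x
        r = B ⊔ 1ℚ
        1≤r = p≤q⊔p B 1ℚ
    in r + 1ℚ , r , ≤-trans (<⇒≤ 0<1) 1≤r , p<p+q r 0<1 ,
       upper-up-≤ x (≤-trans (p≤p⊔q B 1ℚ) (a≤^ k 1≤r)) UB
  lo-open : ∀ {p} → Lo p → ∃[ q ] p < q × Lo q
  lo-open (inj₁ p<0) = let m , p<m , m<0 = <-dense p<0 in m , p<m , inj₁ m<0
  lo-open (inj₂ (r , 0≤r , p<r , Lr)) =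
    let m , p<m , m<r = <-dense p<r in m , p<m , inj₂ (r , 0≤r , m<r , Lr)
  lo-down : ∀ {p q} → p < q → Lo q → Lo p
  lo-down p<q (inj₁ q<0) = inj₁ (<-trans p<q q<0)
  lo-down p<q (inj₂ (r , 0≤r , q<r , Lr)) = inj₂ (r , 0≤r , <-trans p<q q<r , Lr)
  sep : ∀ {q} → Lo q → ¬ Up q
  sep (inj₁ q<0) (s , 0≤s , s<q , Us) = <-asym q<0 (≤-<-trans 0≤s s<q)
  sep (inj₂ (r , 0≤r , q<r , Lr)) (s , 0≤s , s<q , Us) =
    <-asym (lower<upper x Lr Us) (^-mono-< k 0≤s (<-trans s<q q<r))
  loc : ∀ {p q} → p < q → Lo p ⊎ Up q
  loc {p} {q} p<q with p <? 0ℚ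
  ... | yes p<0 = inj₁ (inj₁ p<0)
  ... | no  p≮0 with <-dense p<q
  ... | r , p<r , r<q with <-dense r<q
  ... | s , r<s , s<q
    with ≤-trans (≮⇒≥ p≮0) (<⇒≤ p<r)
  ... | 0≤r with located x (^-mono-< k 0≤r r<s)
  ... | inj₁ Lr = inj₁ (inj₂ (r , 0≤r , p<r , Lr))
  ... | inj₂ Us = inj₂ (s , ≤-trans 0≤r (<⇒≤ r<s) , s<q , Us)

-- x ^[ m / k ] is x raised to the rational exponent m/k
infixr 8 _^[_/_]
_^[_/_] : ℝ≥0 → ℕ → (k : ℕ) → .{{NonZero k}} → ℝ≥0
x ^[ m / k ] = root k (x ^ᴿ m)

fromℕ-positive : ∀ n → .{{NonZero n}} → Positive (fromℕ n)
fromℕ-positive n@(suc _) = positive⁻¹ _ {{normalize-pos n 1}}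

*ᴿ-positive : ∀ x y → Positive x → Positive y → Positive (x *ᴿ y)
*ᴿ-positive x y 0<x 0<y =
  let a , 0<a , La = lower-open x 0<x
      b , 0<b , Lb = lower-open y 0<y
  in inj₂ (a , b , <⇒≤ 0<a , <⇒≤ 0<b , La , Lb , *-pos 0<a 0<b)

^ᴿ-positive : ∀ x m → Positive x → Positive (x ^ᴿ m)
^ᴿ-positive x zero    0<x = 0<1
^ᴿ-positive x (suc m) 0<x = *ᴿ-positive x (x ^ᴿ m) 0<x (^ᴿ-positive x m 0<x)

root-positive : ∀ k .{{_ : NonZero k}} x → Positive x → Positive (root k x)
root-positive k x 0<x =
  let a , 0<a , La = lower-open x 0<x
      δ , 0<δ , δ≤1 , δ1<a = small {1ℚ} 0<1 0<a
      δ<a = subst (_< a) (*-identityʳ δ) δ1<a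
  in inj₂ (δ , <⇒≤ 0<δ , 0<δ , lower-down x (≤-<-trans (^-small k (<⇒≤ 0<δ) δ≤1) δ<a) La)

^[/]-positive : ∀ x m k .{{_ : NonZero k}} → Positive x → Positive (x ^[ m / k ])
^[/]-positive x m k 0<x = root-positive k (x ^ᴿ m) (^ᴿ-positive x m 0<x)

-- Adjacency is decidable, so that degrees and L below are computable numbers.
record Graph (n : ℕ) : Set₁ where
  infix 4 _~_ _~?_
  field
    _~_      : Rel (Fin n) 0ℓ
    ~-sym    : Symmetric _~_
    ~-irrefl : Irreflexive _≡_ _~_
    _~?_     : Decidable _~_

  neighbours : Fin n → Subset n
  neighbours v = tabulate λ u → does (v ~? u)

  N[_] : Fin n → Subset n
  N[ v ] = ⁅ v ⁆ ∪ neighbours v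

  degree : Fin n → ℕ
  degree v = ∣ neighbours v ∣

  maxDegree : ℕ
  maxDegree = max 0 (map degree (allFin n))

  LimitedPacking : ℕ → Subset n → Set
  LimitedPacking k X = ∀ v → ∣ N[ v ] ∩ X ∣ ℕ.≤ k

  limitedPacking? : ∀ k X → Dec (LimitedPacking k X)
  limitedPacking? k X = Fin.all? λ v → ∣ N[ v ] ∩ X ∣ ℕ.≤? k

open Graph using (maxDegree; LimitedPacking; limitedPacking?; N[_])

subsets : ∀ n → List (Subset n)
subsets zero    = [] ∷ []
subsets (suc n) = map (outside ∷_) (subsets n) ++ map (inside ∷_) (subsets n)

∈-subsets : ∀ {n} (X : Subset n) → X ∈ subsets n
∈-subsets []            = here refl
∈-subsets (outside ∷ X) = ∈-++⁺ˡ (∈-map⁺ (outside ∷_) (∈-subsets X))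
∈-subsets {suc n} (inside ∷ X) =
  ∈-++⁺ʳ (map (outside ∷_) (subsets n)) (∈-map⁺ (inside ∷_) (∈-subsets X))

L : ∀ {n} → ℕ → Graph n → ℕ
L {n} k G = max 0 (map ∣_∣ (filter (limitedPacking? G k) (subsets n)))

L-attained : ∀ {n} k (G : Graph n) → ∃[ X ] LimitedPacking G k X × ∣ X ∣ ≡ L k G
L-attained {n} k G
  with argmax-sel (λ m → m) 0 (map ∣_∣ (filter (limitedPacking? G k) (subsets n)))
... | inj₁ L≡0 = ⊥ , empty , trans (∣⊥∣≡0 n) (sym L≡0)
  where
  empty : LimitedPacking G k ⊥
  empty v rewrite ∩-zeroʳ (N[_] G v) | ∣⊥∣≡0 n = ℕ.z≤n
... | inj₂ L∈ =
  let X , X∈ , L≡ = ∈-map⁻ ∣_∣ L∈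
  in X , proj₂ (∈-filter⁻ (limitedPacking? G k) {xs = subsets n} X∈) , sym L≡

L-maximal : ∀ {n} k (G : Graph n) X → LimitedPacking G k X → ∣ X ∣ ℕ.≤ L k G
L-maximal {n} k G X pX = All.lookup (xs≤max 0 _)
  (∈-map⁺ ∣_∣ (∈-filter⁺ (limitedPacking? G k) (∈-subsets X) pX))

C-positive : ∀ {n k} → k ℕ.≤ n → NonZero (n C k)
C-positive {n} {zero} _ = _
C-positive {suc n} {suc k} (ℕ.s≤s k≤n) =
  subst NonZero (nCk+nC[k+1]≡[n+1]C[k+1] n k)
    (ℕ.>-nonZero (ℕ.<-≤-trans (ℕ.>-nonZero⁻¹ _ {{C-positive k≤n}}) (ℕ.m≤m+n (n C k) _)))

c̃ : (Δ j : ℕ) → ℝ≥0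
c̃ Δ j = fromℕ ((Δ ℕ.+ 1) C j)

-- c̃_{k+1}^{1/k} (1+k)^{1+1/k}
denominator : (Δ k : ℕ) → .{{NonZero k}} → ℝ≥0
denominator Δ k = c̃ Δ (k ℕ.+ 1) ^[ 1 / k ] *ᴿ fromℕ (1 ℕ.+ k) ^[ k ℕ.+ 1 / k ]

denominator-positive : ∀ Δ k .{{_ : NonZero k}} → k ℕ.≤ Δ → Positive (denominator Δ k)
denominator-positive Δ k k≤Δ =
  *ᴿ-positive (c̃ Δ (k ℕ.+ 1) ^[ 1 / k ]) (fromℕ (1 ℕ.+ k) ^[ k ℕ.+ 1 / k ])
    (^[/]-positive (c̃ Δ (k ℕ.+ 1)) 1 k
      (fromℕ-positive ((Δ ℕ.+ 1) C (k ℕ.+ 1)) {{C-positive (ℕ.+-monoˡ-≤ 1 k≤Δ)}}))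
    (^[/]-positive (fromℕ (1 ℕ.+ k)) (k ℕ.+ 1) k (fromℕ-positive (1 ℕ.+ k)))

packingBound : (n Δ k : ℕ) → 1 ℕ.≤ k → k ℕ.≤ Δ → ℝ≥0
packingBound n Δ k 1≤k k≤Δ =
  (fromℕ k *ᴿ fromℕ n) /ᴿ denominator Δ k [ denominator-positive Δ k k≤Δ ]
  where instance _ = ℕ.>-nonZero 1≤k

{-# OPTIONS --safe #-}

-- The complete graph on n = k + 1 vertices, with Δ = k, already suffices.
-- Every closed neighbourhood is the whole vertex set, so L_k = k, while
-- C(Δ+1,k+1) = 1 turns the bound into (1+ε) k / n^{1/k}.  It remains to see that
-- n ≤ (1+ε)^k for large n, which follows by squaring Bernoulli's inequality.

module Submission where

open import Defs
open import Algebra.Bundles using (CommutativeRing)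
import Algebra.Properties.CommutativeSemiring.Exp as Exp
open import Data.Fin using (Fin)
import Data.Fin as Fin
import Data.Fin.Properties as Fin
open import Data.Fin.Subset using (⁅_⁆; ∁; _∩_; ∣_∣)
  renaming (_∈_ to _∈ₛ_)
open import Data.Fin.Subset.Properties
  using (x∈⁅x⁆; x∈⁅y⁆⇒x≡y; x∉p⇒x∈∁p; x∈∁p⇒x∉p; x∈p∪q⁺; x∈p∩q⁺; p⊆q⇒∣p∣≤∣q∣;
         ⊆-antisym; ∣∁p∣≡n∸∣p∣; ∣⁅x⁆∣≡1)
import Data.Integer as ℤ
import Data.Integer.Properties as ℤ
open import Data.List using (map; allFin)
open import Data.List.Extrema.Nat using (max≤v⁺; xs≤max)
open import Data.List.Membership.Propositional.Properties using (∈-map⁺; ∈-allFin)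
import Data.List.Relation.Unary.All as All
import Data.List.Relation.Unary.All.Properties as All
open import Data.Nat using (ℕ; zero; suc; NonZero; _≤_; z≤n; s≤s)
import Data.Nat as ℕ
import Data.Nat.Properties as ℕ
open import Data.Nat.Combinatorics using (nCn≡1)
open import Data.Product using (Σ-syntax; ∃-syntax; _×_; _,_)
open import Data.Rational using (ℚ; 0ℚ; 1ℚ; _+_; _*_; _-_; _<_; nonNegative; positive)
import Data.Rational as ℚ
open import Data.Rational.Properties
open import Data.Rational.Solver using (module +-*-Solver)
import Data.Rational.Unnormalised as ℚᵘ
import Data.Rational.Unnormalised.Properties as ℚᵘ
open import Data.Sum using (inj₁; inj₂)
open import Data.Vec.Properties using (lookup∘tabulate; []=⇒lookup; lookup⇒[]=)
open import Relation.Binary.PropositionalEquality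
open import Relation.Nullary using (¬?; yes; no)
open import Relation.Nullary.Decidable using (dec-true)
open import Algebra.Definitions.RawSemiring ℚ.+-*-rawSemiring using (_^_)

open ℝ≥0
open Graph using (maxDegree; degree; neighbours; N[_])
open +-*-Solver using (solve; _:=_; _:+_; _:*_; _:-_; con)
open Exp (CommutativeRing.commutativeSemiring +-*-commutativeRing) using (^-distrib-*)

-- Complete graphs: degrees and limited packings.

K : ∀ n → Graph n
K n = record
  { _~_      = _≢_
  ; ~-sym    = ≢-sym
  ; ~-irrefl = λ eq neq → neq eq
  ; _~?_     = λ u v → ¬? (u Fin.≟ v)
  }

∈-neighbours⁺ : ∀ {n} (u v : Fin n) → v ≢ u → u ∈ₛ neighbours (K n) v
∈-neighbours⁺ u v v≢u = lookup⇒[]= u _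
  (trans (lookup∘tabulate _ u) (dec-true (¬? (v Fin.≟ u)) v≢u))

∈-neighbours⁻ : ∀ {n} (u v : Fin n) → u ∈ₛ neighbours (K n) v → v ≢ u
∈-neighbours⁻ u v u∈ with v Fin.≟ u | trans (sym (lookup∘tabulate _ u)) ([]=⇒lookup u∈)
... | no v≢u | _  = v≢u
... | yes _  | ()

neighbours-K : ∀ {n} (v : Fin n) → neighbours (K n) v ≡ ∁ ⁅ v ⁆
neighbours-K v = ⊆-antisym
  (λ {u} u∈ → x∉p⇒x∈∁p λ u∈v → ∈-neighbours⁻ u v u∈ (sym (x∈⁅y⁆⇒x≡y v u∈v)))
  (λ {u} u∈ → ∈-neighbours⁺ u v λ { refl → x∈∁p⇒x∉p u∈ (x∈⁅x⁆ v) })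

degree-K : ∀ k (v : Fin (suc k)) → degree (K (suc k)) v ≡ k
degree-K k v = trans (cong ∣_∣ (neighbours-K v))
  (trans (∣∁p∣≡n∸∣p∣ ⁅ v ⁆) (cong (suc k ℕ.∸_) (∣⁅x⁆∣≡1 v)))

maxDegree-K : ∀ k → maxDegree (K (suc k)) ≡ k
maxDegree-K k = ℕ.≤-antisym
  (max≤v⁺ {xs = map (degree (K (suc k))) (allFin (suc k))} z≤n (All.map⁺ (All.universal (λ v → ℕ.≤-reflexive (degree-K k v)) (allFin (suc k)))))
  (subst (_≤ maxDegree (K (suc k))) (degree-K k Fin.zero)
    (All.lookup (xs≤max 0 _) (∈-map⁺ (degree (K (suc k))) (∈-allFin Fin.zero))))

N[]-K : ∀ {n} (v u : Fin n) → u ∈ₛ N[_] (K n) v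
N[]-K v u with v Fin.≟ u
... | yes refl = x∈p∪q⁺ (inj₁ (x∈⁅x⁆ v))
... | no  v≢u  = x∈p∪q⁺ (inj₂ (∈-neighbours⁺ u v v≢u))

-- A packing attaining the maximum lies inside the closed neighbourhood of vertex zero, which
-- contains every vertex; the packing condition at that single vertex then bounds its whole size.
L-K≤ : ∀ n k → L k (K (suc n)) ≤ k
L-K≤ n k =
  let X , packing , ∣X∣≡L = L-attained k (K (suc n))
  in subst (_≤ k) ∣X∣≡L (ℕ.≤-trans
       (p⊆q⇒∣p∣≤∣q∣ {p = X} {q = N[_] (K (suc n)) Fin.zero ∩ X} λ {u} u∈X → x∈p∩q⁺ (N[]-K Fin.zero u , u∈X))
       (packing Fin.zero))

-- Growth of rational powers via Bernoulli's inequality.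

infix 9 _/1
_/1 : ℕ → ℚ
n /1 = ℤ.+ n ℚ./ 1

-- `_/1` normalises its fraction, so the equation is checked among unnormalised rationals and
-- carried back.
suc/1 : ∀ m → suc m /1 ≡ 1ℚ + m /1
suc/1 m = sym (toℚᵘ-injective (ℚᵘ.≃-trans (toℚᵘ-homo-+ 1ℚ (m /1))
  (ℚᵘ.≃-trans (ℚᵘ.+-congʳ (ℚ.toℚᵘ 1ℚ) (toℚᵘ-fromℚᵘ (ℚᵘ.mkℚᵘ (ℤ.+ m) 0)))
  (ℚᵘ.≃-trans (ℚᵘ.*≡* (cong (λ z → (ℤ.+ 1 ℤ.+ z) ℤ.* ℤ.+ 1) (ℤ.*-identityʳ (ℤ.+ m))))
    (ℚᵘ.≃-sym (toℚᵘ-fromℚᵘ (ℚᵘ.mkℚᵘ (ℤ.+ suc m) 0)))))))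

/1≡fromℕℚ : ∀ n → n /1 ≡ fromℕℚ n
/1≡fromℕℚ zero    = refl
/1≡fromℕℚ (suc n) = trans (suc/1 n) (cong (1ℚ +_) (/1≡fromℕℚ n))

0≤/1 : ∀ n → 0ℚ ℚ.≤ n /1
0≤/1 n = nonNegative⁻¹ _ {{normalize-nonNeg n 1}}

0<suc/1 : ∀ n → 0ℚ < suc n /1
0<suc/1 n = fromℕ-positive (suc n)

/1-mono-≤ : ∀ {m n} → m ≤ n → m /1 ℚ.≤ n /1
/1-mono-≤ {n = n} z≤n = 0≤/1 n
/1-mono-≤ {suc m} {suc n} (s≤s m≤n) =
  subst₂ ℚ._≤_ (sym (suc/1 m)) (sym (suc/1 n)) (+-monoʳ-≤ 1ℚ (/1-mono-≤ m≤n))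

p≤p+q : ∀ p {q} → 0ℚ ℚ.≤ q → p ℚ.≤ p + q
p≤p+q p {q} 0≤q = subst (ℚ._≤ p + q) (+-identityʳ p) (+-monoʳ-≤ p 0≤q)

bernoulli : ∀ {d} k → 0ℚ ℚ.≤ d → 1ℚ + k /1 * d ℚ.≤ (1ℚ + d) ^ k
bernoulli {d} zero 0≤d = ≤-reflexive (trans (cong (1ℚ +_) (*-zeroˡ d)) (+-identityʳ 1ℚ))
bernoulli {d} (suc k) 0≤d = begin
  1ℚ + suc k /1 * d                     ≡⟨ cong (λ m → 1ℚ + m * d) (suc/1 k) ⟩
  -- The added term `k /1 * (d * d)` completes the product `(1ℚ + d) * (1ℚ + k /1 * d)`.
  1ℚ + (1ℚ + k /1) * d                  ≤⟨ p≤p+q _ (*-nonNeg (0≤/1 k) (*-nonNeg 0≤d 0≤d)) ⟩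
  1ℚ + (1ℚ + k /1) * d + k /1 * (d * d) ≡⟨ solve 2 (λ m d →
      con 1ℚ :+ (con 1ℚ :+ m) :* d :+ m :* (d :* d)
        := (con 1ℚ :+ d) :* (con 1ℚ :+ m :* d)) refl (k /1) d ⟩
  (1ℚ + d) * (1ℚ + k /1 * d)            ≤⟨ *-monoˡ-≤-nonNeg (1ℚ + d) {{nonNegative 0≤1+d}} (bernoulli k 0≤d) ⟩
  (1ℚ + d) * (1ℚ + d) ^ k               ∎
  where
  open ≤-Reasoning
  0≤1+d = ≤-trans 0≤d (subst (ℚ._≤ 1ℚ + d) (+-identityˡ d) (+-monoˡ-≤ d (<⇒≤ 0<1)))

-- Bernoulli's bound is only linear in `k`, with a slope that may be below one. Its square contains
-- the quadratic term `(k d)²`, which is at least `k` once `k d² ≥ 1`.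
suc≤power : ∀ {d} k → 0ℚ ℚ.≤ d → 1ℚ ℚ.≤ k /1 * (d * d) →
            suc k /1 ℚ.≤ ((1ℚ + d) * (1ℚ + d)) ^ k
suc≤power {d} k 0≤d 1≤kd² = begin
  suc k /1                                     ≡⟨ suc/1 k ⟩
  1ℚ + m                                       ≡⟨ cong (1ℚ +_) (*-identityʳ m) ⟨
  1ℚ + m * 1ℚ                                  ≤⟨ +-monoʳ-≤ 1ℚ (*-monoˡ-≤-nonNeg m {{nonNegative (0≤/1 k)}} 1≤kd²) ⟩
  1ℚ + m * (m * (d * d))                       ≤⟨ p≤p+q _ (+-mono-≤ 0≤md 0≤md) ⟩
  1ℚ + m * (m * (d * d)) + (m * d + m * d)     ≡⟨ solve 2 (λ m d →
      con 1ℚ :+ m :* (m :* (d :* d)) :+ (m :* d :+ m :* d)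
        := (con 1ℚ :+ m :* d) :* (con 1ℚ :+ m :* d)) refl m d ⟩
  (1ℚ + m * d) * (1ℚ + m * d)                  ≤⟨ *-mono-≤₀ 0≤1+md (bernoulli k 0≤d) 0≤1+md (bernoulli k 0≤d) ⟩
  (1ℚ + d) ^ k * (1ℚ + d) ^ k                  ≡⟨ ^-distrib-* (1ℚ + d) (1ℚ + d) k ⟨
  ((1ℚ + d) * (1ℚ + d)) ^ k                    ∎
  where
  open ≤-Reasoning
  m = k /1
  0≤md = *-nonNeg (0≤/1 k) 0≤d
  0≤1+md = ≤-trans (<⇒≤ 0<1) (p≤p+q 1ℚ 0≤md)

square-between : ∀ {A} → 1ℚ < A → ∃[ d ] 0ℚ < d × (1ℚ + d) * (1ℚ + d) < A
square-between {A} 1<A =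
  -- The factor three comes from `(1 + d)² = 1 + d (2 + d) ≤ 1 + 3 d` for `d ≤ 1`.
  let d , 0<d , d≤1 , 3d<A-1 = small {1ℚ + 1ℚ + 1ℚ} (0<+ (0<+ 0<1 0<1) 0<1) (0<q-p 1<A)
      open ≤-Reasoning
  in d , 0<d , (begin-strict
       (1ℚ + d) * (1ℚ + d)       ≡⟨ solve 1 (λ d → (con 1ℚ :+ d) :* (con 1ℚ :+ d)
                                     := con 1ℚ :+ d :* (con 1ℚ :+ con 1ℚ :+ d)) refl d ⟩
       1ℚ + d * (1ℚ + 1ℚ + d)    ≤⟨ +-monoʳ-≤ 1ℚ (*-monoˡ-≤-nonNeg d {{nonNegative (<⇒≤ 0<d)}}
                                     (+-monoʳ-≤ (1ℚ + 1ℚ) d≤1)) ⟩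
       1ℚ + d * (1ℚ + 1ℚ + 1ℚ)   <⟨ +-monoʳ-< 1ℚ 3d<A-1 ⟩
       1ℚ + (A - 1ℚ)             ≡⟨ p+[q-p] 1ℚ A ⟩
       A                         ∎)

-- The base `B` does not depend on `k` and stays strictly below `A`; the gap is what the open cuts
-- consume later.
eventually-suc≤power : ∀ {A} → 1ℚ < A →
  ∃[ B ] 0ℚ < B × B < A × (∃[ N ] ∀ k → N ≤ k → suc k /1 ℚ.≤ B ^ k)
eventually-suc≤power 1<A =
  let d , 0<d , B<A      = square-between 1<A
      r , 0<r , d²r≡1    = reciprocal (*-pos 0<d 0<d)
      -- `N` exceeds `1 / d²`, so `k d² ≥ 1` for every `k ≥ N`.
      N , r<N            = exceeds r
      0≤d²               = <⇒≤ (*-pos 0<d 0<d)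
      0<1+d              = 0<+ 0<1 0<d
  in (1ℚ + d) * (1ℚ + d) , *-pos 0<1+d 0<1+d , B<A , N , λ k N≤k →
     suc≤power k (<⇒≤ 0<d) (subst (ℚ._≤ k /1 * (d * d)) (trans (*-comm r (d * d)) d²r≡1)
       (*-monoʳ-≤-nonNeg (d * d) {{nonNegative 0≤d²}}
         (≤-trans (<⇒≤ (subst (r <_) (sym (/1≡fromℕℚ N)) r<N)) (/1-mono-≤ N≤k))))

-- Rational upper bounds for reals, applied to the denominator.

infix 4 _≤ℚ_
-- This is the non-strict bound: `a` itself need not lie in the open upper cut, so exact values such
-- as `1ℚ` are admissible bounds.
_≤ℚ_ : ℝ≥0 → ℚ → Set
x ≤ℚ a = ∀ {q} → a < q → Upper x q

*ᴿ-≤ℚ : ∀ x y {a b} → 0ℚ ℚ.≤ a → 0ℚ ℚ.≤ b → x ≤ℚ a → y ≤ℚ b → x *ᴿ y ≤ℚ a * b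
*ᴿ-≤ℚ x y {a} {b} 0≤a 0≤b x≤a y≤b {q} ab<q =
  let 0≤a+b = +-mono-≤ 0≤a 0≤b
      -- Since `δ ≤ 1`, the excess `δ * (a + b + δ)` is at most `δ * (a + b + 1ℚ)`, which is kept
      -- below `q - a * b`.
      δ , 0<δ , δ≤1 , δM< = small {a + b + 1ℚ} (+-mono-≤-< 0≤a+b 0<1) (0<q-p ab<q)
      open ≤-Reasoning
  in a + δ , b + δ , x≤a (p<p+q a 0<δ) , y≤b (p<p+q b 0<δ) , (begin-strict
       (a + δ) * (b + δ)           ≡⟨ product-shift a b δ ⟨
       a * b + δ * (a + b + δ)     ≤⟨ +-monoʳ-≤ (a * b) (*-monoˡ-≤-nonNeg δ {{nonNegative (<⇒≤ 0<δ)}}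
                                       (+-monoʳ-≤ (a + b) δ≤1)) ⟩
       a * b + δ * (a + b + 1ℚ)    <⟨ +-monoʳ-< (a * b) δM< ⟩
       a * b + (q - a * b)         ≡⟨ p+[q-p] (a * b) q ⟩
       q                           ∎)

^ᴿ-≤ℚ : ∀ x {a} m → 0ℚ ℚ.≤ a → x ≤ℚ a → x ^ᴿ m ≤ℚ a ^ m
^ᴿ-≤ℚ x zero    0≤a x≤a = λ 1<q → 1<q
^ᴿ-≤ℚ x (suc m) 0≤a x≤a =
  *ᴿ-≤ℚ x (x ^ᴿ m) 0≤a (^-nonNeg m 0≤a) x≤a (^ᴿ-≤ℚ x m 0≤a x≤a)

root-≤ℚ : ∀ k .{{_ : NonZero k}} x {r} → 0ℚ ℚ.≤ r → x ≤ℚ r ^ k → root k x ≤ℚ r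
root-≤ℚ k x 0≤r x≤ r<q =
  let s , r<s , s<q = <-dense r<q
  in s , ≤-trans 0≤r (<⇒≤ r<s) , s<q , x≤ (^-mono-< k 0≤r r<s)

≤ℚ-trans : ∀ x {a b} → x ≤ℚ a → a ℚ.≤ b → x ≤ℚ b
≤ℚ-trans x x≤a a≤b b<q = x≤a (≤-<-trans a≤b b<q)

c̃-diagonal-≤ℚ : ∀ k → c̃ k (k ℕ.+ 1) ≤ℚ 1ℚ
c̃-diagonal-≤ℚ k {q} 1<q = subst (λ m → m /1 < q) (sym (nCn≡1 (k ℕ.+ 1))) 1<q

-- Write `n = k + 1`. The binomial factor is `C(n,n) = 1`, whose root is at most one. For the other
-- factor, `n ^ (k + 1) = n ^ k * n ≤ (n * B) ^ k`, and a `k`-th root is taken.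
denominator-diagonal-≤ℚ : ∀ k .{{_ : NonZero k}} {B} → 0ℚ ℚ.≤ B → suc k /1 ℚ.≤ B ^ k →
                          denominator k k ≤ℚ suc k /1 * B
denominator-diagonal-≤ℚ k {B} 0≤B n≤Bᵏ =
  ≤ℚ-trans (denominator k k)
    (*ᴿ-≤ℚ (c̃ k (k ℕ.+ 1) ^[ 1 / k ]) (fromℕ (1 ℕ.+ k) ^[ k ℕ.+ 1 / k ])
      (<⇒≤ 0<1) 0≤nB
      (root-≤ℚ k (c̃ k (k ℕ.+ 1) ^ᴿ 1) (<⇒≤ 0<1)
        (≤ℚ-trans (c̃ k (k ℕ.+ 1) ^ᴿ 1)
          (^ᴿ-≤ℚ (c̃ k (k ℕ.+ 1)) 1 (<⇒≤ 0<1) (c̃-diagonal-≤ℚ k)) (1≤^ k ≤-refl)))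
      (root-≤ℚ k (fromℕ (1 ℕ.+ k) ^ᴿ (k ℕ.+ 1)) 0≤nB
        (≤ℚ-trans (fromℕ (1 ℕ.+ k) ^ᴿ (k ℕ.+ 1))
          (^ᴿ-≤ℚ (fromℕ (1 ℕ.+ k)) (k ℕ.+ 1) (0≤/1 (suc k)) (λ n<q → n<q)) nᵏ⁺¹≤)))
    (≤-reflexive (*-identityˡ (n * B)))
  where
  n = suc k /1
  0≤nB = *-nonNeg (0≤/1 (suc k)) 0≤B
  open ≤-Reasoning
  nᵏ⁺¹≤ : n ^ (k ℕ.+ 1) ℚ.≤ (n * B) ^ k
  nᵏ⁺¹≤ = begin
    n ^ (k ℕ.+ 1)   ≡⟨ cong (n ^_) (ℕ.+-comm k 1) ⟩
    n * n ^ k       ≡⟨ *-comm n (n ^ k) ⟩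
    n ^ k * n       ≤⟨ *-monoˡ-≤-nonNeg (n ^ k) {{nonNegative (^-nonNeg k (0≤/1 (suc k)))}} n≤Bᵏ ⟩
    n ^ k * B ^ k   ≡⟨ ^-distrib-* n B k ⟨
    (n * B) ^ k     ∎

-- Rational lower bounds for reals, applied to the packing bound.

*ᴿ-lower : ∀ x y {a b} → 0ℚ ℚ.≤ a → 0ℚ ℚ.≤ b → Lower x a → Lower y b → Lower (x *ᴿ y) (a * b)
*ᴿ-lower x y 0≤a 0≤b La Lb =
  -- Both factors are enlarged within their open cuts because the product cut asks for a strict
  -- inequality.
  let a′ , a<a′ , La′ = lower-open x La
      b′ , b<b′ , Lb′ = lower-open y Lb
  in inj₂ (a′ , b′ , ≤-trans 0≤a (<⇒≤ a<a′) , ≤-trans 0≤b (<⇒≤ b<b′) , La′ , Lb′ ,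
           *-mono-<₀ 0≤a a<a′ 0≤b b<b′)

recip-lower : ∀ x (0<x : Positive x) {u v} → 0ℚ < v → u * v ≡ 1ℚ → Upper x u → Lower (recip x 0<x) v
recip-lower x 0<x {u} {v} 0<v uv≡1 Uu =
  -- Shrinking `u` to `w` makes `1 / w` strictly larger than `v = 1 / u`, as the reciprocal cut
  -- requires.
  let w , w<u , Uw = upper-open x Uu
      r , 0<r , wr≡1 = reciprocal (upper-pos x Uw)
  in r , w , reciprocal-< 0<r 0<v wr≡1 uv≡1 w<u , Uw ,
     ≤-reflexive (trans (*-comm r w) wr≡1)

1+ᴿ-lower : ∀ x {e} → Lower x e → Lower (1ᴿ +ᴿ x) (1ℚ + e)
1+ᴿ-lower x {e} Le =
  -- The slack `f - e` in the second summand allows a first summand `a` strictly below one with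
  -- `a + f` still above `1ℚ + e`.
  let f , e<f , Lf = lower-open x Le
      a , <a , a<1 = <-dense (subst (1ℚ + e - f <_)
        (solve 1 (λ f → con 1ℚ :+ f :- f := con 1ℚ) refl f)
        (+-monoˡ-< (ℚ.- f) (+-monoʳ-< 1ℚ e<f)))
  in a , f , a<1 , Lf ,
     subst (_< a + f) (solve 2 (λ e f → con 1ℚ :+ e :- f :+ f := con 1ℚ :+ e) refl e f)
       (+-monoˡ-< f <a)

packingBound-diagonal-lower :
  ∀ k (1≤k : 1 ≤ k) (k≤k : k ≤ k) (y : ℝ≥0) {A B q} →
  Lower y A → 0ℚ < B → B < A → suc k /1 ℚ.≤ B ^ k → 0ℚ ℚ.≤ q → q < k /1 →
  Lower (y *ᴿ packingBound (suc k) k k 1≤k k≤k) q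
packingBound-diagonal-lower k 1≤k k≤k y {A} {B} {q} LA 0<B B<A n≤Bᵏ 0≤q q<k =
  -- `B < C` puts `n * C` in the upper cut of the denominator, and `C < A` puts `a = n C / A` below
  -- `n`. The lower bounds `A`, `q`, `a` and `1 / (n C)` of the four factors then multiply to
  -- exactly `q`.
  let C , B<C , C<A = <-dense B<A
      0<C           = <-trans 0<B B<C
      0<A           = <-trans 0<B B<A
      r , 0<r , Ar≡1 = reciprocal 0<A
      v , 0<v , uv≡1 = reciprocal (*-pos (0<suc/1 k) 0<C)
      a = n * C * r
      0≤a = <⇒≤ (*-pos (*-pos (0<suc/1 k) 0<C) 0<r)
      a<n = subst (a <_) (trans (*-assoc n A r) (trans (cong (n *_) Ar≡1) (*-identityʳ n)))
              (*-monoˡ-<-pos r {{positive 0<r}} (*-monoʳ-<-pos n {{positive (0<suc/1 k)}} C<A))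
      0≤qa = *-nonNeg 0≤q 0≤a
      Lkn = *ᴿ-lower (fromℕ k) (fromℕ (suc k)) 0≤q 0≤a q<k a<n
      0<D = denominator-positive k k k≤k
      LD  = recip-lower (denominator k k) 0<D 0<v uv≡1
              (denominator-diagonal-≤ℚ k (<⇒≤ 0<B) n≤Bᵏ
                (*-monoʳ-<-pos n {{positive (0<suc/1 k)}} B<C))
      Lbound = *ᴿ-lower (fromℕ k *ᴿ fromℕ (suc k)) (recip (denominator k k) 0<D) 0≤qa (<⇒≤ 0<v) Lkn LD
      open ≡-Reasoning
      A*≡q = begin
        A * (q * (n * C * r) * v)       ≡⟨ solve 5 (λ A q u r v →
             A :* (q :* (u :* r) :* v) := q :* (A :* r) :* (u :* v)) refl A q (n * C) r v ⟩
        q * (A * r) * (n * C * v)       ≡⟨ cong₂ (λ s t → q * s * t) Ar≡1 uv≡1 ⟩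
        q * 1ℚ * 1ℚ                     ≡⟨ trans (*-identityʳ (q * 1ℚ)) (*-identityʳ q) ⟩
        q                               ∎
  in subst (Lower (y *ᴿ packingBound (suc k) k k 1≤k k≤k)) A*≡q
       (*ᴿ-lower y (packingBound (suc k) k k 1≤k k≤k) (<⇒≤ 0<A) (*-nonNeg 0≤qa (<⇒≤ 0<v)) LA Lbound)
  where
  instance _ = ℕ.>-nonZero 1≤k
  n = suc k /1

-- Comparison of the packing number with the bound.

-- `Δ` is a variable so that matching `Δ ≡ k` rewrites the bound together with its dependence on
-- `k≤Δ`; the maximum degree equals `k` only propositionally.
≤ᴿ-packingBound : ∀ k l Δ (1≤k : 1 ≤ k) (k≤Δ : k ≤ Δ) (y : ℝ≥0) {A B} →
  Δ ≡ k → l ≤ k → Lower y A → 0ℚ < B → B < A → suc k /1 ℚ.≤ B ^ k →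
  fromℕ l ≤ᴿ y *ᴿ packingBound (suc k) Δ k 1≤k k≤Δ
≤ᴿ-packingBound k l _ 1≤k k≤Δ y refl l≤k LA 0<B B<A n≤Bᵏ {q} q<l with q <? 0ℚ
... | yes q<0 = inj₁ q<0
... | no  q≮0 = packingBound-diagonal-lower k 1≤k k≤Δ y LA 0<B B<A n≤Bᵏ
                  (≮⇒≥ q≮0) (<-≤-trans q<l (/1-mono-≤ l≤k))

theorem2 : (ε : ℝ≥0) → Positive ε →
    Σ[ N ∈ ℕ ] ((n : ℕ) → N ≤ n →
    Σ[ G ∈ Graph n ] Σ[ k ∈ ℕ ] Σ[ 1≤k ∈ 1 ≤ k ] Σ[ k≤Δ ∈ k ≤ Graph.maxDegree G ]
    (fromℕ (L k G) ≤ᴿ (1ᴿ +ᴿ ε) *ᴿ packingBound n (Graph.maxDegree G) k 1≤k k≤Δ))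
theorem2 ε 0<ε =
  let e , 0<e , Le = lower-open ε 0<ε
      B , 0<B , B<1+e , N , suc≤Bᵏ = eventually-suc≤power (p<p+q 1ℚ 0<e)
  -- With `n = k + 1`, the threshold `N + 2` yields `k ≥ N + 1`, hence both `k ≥ 1` and `k ≥ N`.
  in suc (suc N) , λ where
       (suc k) (s≤s N<k) →
         let 1≤k = ℕ.≤-trans (s≤s z≤n) N<k
             k≤Δ = ℕ.≤-reflexive (sym (maxDegree-K k))
         in K (suc k) , k , 1≤k , k≤Δ ,
            ≤ᴿ-packingBound k (L k (K (suc k))) (maxDegree (K (suc k))) 1≤k k≤Δ (1ᴿ +ᴿ ε)
              (maxDegree-K k) (L-K≤ k k) (1+ᴿ-lower ε Le) 0<B B<1+e
              (suc≤Bᵏ k (ℕ.≤-trans (ℕ.n≤1+n N) N<k))
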